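{- For $n\ge 0$ let $a_n$ be the number of permutations of $\{1,\dots,n\}$ that simultaneously avoid the consecutive patterns $123$, $231$ and $312$ (with $a_0=1$), and let $E(x)=\sum_{n\ge 0}a_n\frac{x^n}{n!}$. Then $$E(x)=1+x(\sec(x)+\tan(x)).$$
   Context: A permutation $\pi=\pi_1\pi_2\cdots\pi_n$ of $\{1,\dots,n\}$ contains the consecutive (dash-free generalized) pattern $\tau=\tau_1\tau_2\tau_3$ if there is an $i$ with $1\le i\le n-2$ such that $\pi_i\pi_{i+1}\pi_{i+2}$ is order-isomorphic to $\tau_1\tau_2\tau_3$. Otherwise $\pi$ avoids $\tau$. -}

module Defs where

open import Data.Fin.Base as Fin using (Fin; toℕ)
open import Data.Fin.Properties using (any?; all?) renaming (_≟_ to _≟ᶠ_)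
open import Data.Integer.Base as ℤ using (ℤ; +_)
open import Data.List.Base as List using (List; allFin; cartesianProductWith; filter; length)
open import Data.List.Membership.Propositional using (_∈_)
open import Data.List.Membership.Propositional.Properties
  using (∈-allFin; ∈-cartesianProductWith⁺)
open import Data.List.Relation.Unary.Any using (here)
import Data.List.Relation.Unary.All as ListAll
import Data.List.Relation.Unary.AllPairs as ListAllPairs
import Data.List.Relation.Unary.Unique.Propositional as ListUnique
open import Data.List.Relation.Unary.Unique.Propositional.Properties
  using (allFin⁺; cartesianProductWith⁺)
open import Data.Nat.Base as ℕ using (ℕ; zero; suc; _∸_; _<_; _!)
import Data.Nat.Properties as ℕ
open import Data.Product.Base using (∃-syntax; _×_; _,_)
open import Data.Rational.Base as ℚ using (ℚ; 0ℚ; 1ℚ; NonZero; 1/_; _/_)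
import Data.Rational.Properties as ℚ
open import Data.Vec.Base using (Vec; []; _∷_; lookup)
import Data.Vec.Functional as Vector
open import Data.Vec.Functional using (Vector)
open import Data.Vec.Properties using (∷-injective)
open import Data.Vec.Relation.Unary.AllPairs using (allPairs?)
open import Data.Vec.Relation.Unary.Unique.Propositional using (Unique)
open import Function.Bundles using (_⇔_; mk⇔; Equivalence)
open import Algebra.Properties.CommutativeMonoid.Sum ℚ.+-0-commutativeMonoid
  using (sum; sum-cong-≗)
open import Relation.Binary.PropositionalEquality
  using (_≡_; refl; trans; cong; module ≡-Reasoning)
open import Relation.Nullary using (Dec; ¬_; ¬?; _×-dec_; _→-dec_)
open import Relation.Nullary.Decidable using (map′)
open import Relation.Unary using (Decidable)

------------------------------------------------------------------------
-- Consecutive patterns in permutations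

-- A permutation of an n-element set in one-line notation; the letters are
-- 0, …, n ∸ 1 instead of 1, …, n, which does not affect order-isomorphism.

IsPermutation : ∀ {n} → Vec (Fin n) n → Set
IsPermutation = Unique

OrderIsomorphic : ∀ {m} → Vec ℕ m → Vec ℕ m → Set
OrderIsomorphic u v = ∀ a b → lookup u a < lookup u b ⇔ lookup v a < lookup v b

factor : ∀ {n} → Vec (Fin n) n → Fin n → Fin n → Fin n → Vec ℕ 3
factor π i j k = toℕ (lookup π i) ∷ toℕ (lookup π j) ∷ toℕ (lookup π k) ∷ []

Contains : ∀ {n} → Vec ℕ 3 → Vec (Fin n) n → Set
Contains τ π = ∃[ i ] ∃[ j ] ∃[ k ]
  toℕ j ≡ suc (toℕ i) × toℕ k ≡ suc (toℕ j) ×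
  OrderIsomorphic (factor π i j k) τ

Avoids : ∀ {n} → Vec ℕ 3 → Vec (Fin n) n → Set
Avoids τ π = ¬ Contains τ π

p123 p231 p312 : Vec ℕ 3
p123 = 1 ∷ 2 ∷ 3 ∷ []
p231 = 2 ∷ 3 ∷ 1 ∷ []
p312 = 3 ∷ 1 ∷ 2 ∷ []

AvoidsAll : ∀ {n} → Vec (Fin n) n → Set
AvoidsAll π = Avoids p123 π × Avoids p231 π × Avoids p312 π

isPermutation? : ∀ {n} → Decidable (IsPermutation {n})
isPermutation? = allPairs? (λ x y → ¬? (x ≟ᶠ y))

orderIsomorphic? : ∀ {m} (u v : Vec ℕ m) → Dec (OrderIsomorphic u v)
orderIsomorphic? u v = all? λ a → all? λ b →
  let p = lookup u a ℕ.<? lookup u b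
      q = lookup v a ℕ.<? lookup v b
  in map′ (λ (f , g) → mk⇔ f g)
          (λ e → Equivalence.to e , Equivalence.from e)
          ((p →-dec q) ×-dec (q →-dec p))

contains? : ∀ {n} τ → Decidable (Contains {n} τ)
contains? τ π = any? λ i → any? λ j → any? λ k →
  toℕ j ℕ.≟ suc (toℕ i) ×-dec toℕ k ℕ.≟ suc (toℕ j) ×-dec
  orderIsomorphic? (factor π i j k) τ

avoids? : ∀ {n} τ → Decidable (Avoids {n} τ)
avoids? τ π = ¬? (contains? τ π)

avoidsAll? : ∀ {n} → Decidable (AvoidsAll {n})
avoidsAll? π = avoids? p123 π ×-dec avoids? p231 π ×-dec avoids? p312 π

words : ∀ n k → List (Vec (Fin n) k)
words n zero    = List.[ [] ]
words n (suc k) = cartesianProductWith _∷_ (allFin n) (words n k)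

∈-words : ∀ {n k} (w : Vec (Fin n) k) → w ∈ words n k
∈-words []      = here refl
∈-words (x ∷ w) = ∈-cartesianProductWith⁺ _∷_ (∈-allFin x) (∈-words w)

words-unique : ∀ n k → ListUnique.Unique (words n k)
words-unique n zero    = ListAll.[] ListAllPairs.∷ ListAllPairs.[]
words-unique n (suc k) =
  cartesianProductWith⁺ _∷_ ∷-injective (allFin⁺ n) (words-unique n k)

permutations : ∀ n → List (Vec (Fin n) n)
permutations n = filter isPermutation? (words n n)

avoiders : ∀ n → List (Vec (Fin n) n)
avoiders n = filter avoidsAll? (permutations n)

a : ℕ → ℕ
a n = length (avoiders n)

------------------------------------------------------------------------
-- Formal power series over ℚ, as coefficient sequences

Series : Set
Series = ℕ → ℚ

infix  4 _≈_
infixl 6 _+_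
infixl 7 _*_

_≈_ : Series → Series → Set
f ≈ g = ∀ n → f n ≡ g n

one : Series
one zero    = 1ℚ
one (suc _) = 0ℚ

x : Series
x 1 = 1ℚ
x _ = 0ℚ

_+_ : Series → Series → Series
(f + g) n = f n ℚ.+ g n

_*_ : Series → Series → Series
(f * g) n = sum {suc n} λ i → f (toℕ i) ℚ.* g (n ∸ toℕ i)

-- The reciprocal g of f is determined by g₀ = 1/f₀ and
-- gₙ₊₁ = - (1/f₀) Σ_{i ≤ n} fᵢ₊₁ gₙ₋ᵢ.  To make the recursion structural,
-- reversedPrefix f n lists gₙ₋₁, …, g₀.

module _ (f : Series) .{{_ : NonZero (f 0)}} where

  nextCoeff : ∀ {n} → Vector ℚ n → ℚ
  nextCoeff {zero}  _ = 1/ f 0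
  nextCoeff {suc n} h = ℚ.- (1/ f 0 ℚ.* sum λ i → f (suc (toℕ i)) ℚ.* h i)

  reversedPrefix : ∀ n → Vector ℚ n
  reversedPrefix zero    = Vector.[]
  reversedPrefix (suc n) = nextCoeff (reversedPrefix n) Vector.∷ reversedPrefix n

  reciprocal : Series
  reciprocal n = nextCoeff (reversedPrefix n)

  reversedPrefix-lookup : ∀ n (i : Fin n) →
                          reversedPrefix n i ≡ reciprocal (n ∸ suc (toℕ i))
  reversedPrefix-lookup (suc n) Fin.zero    = refl
  reversedPrefix-lookup (suc n) (Fin.suc i) = reversedPrefix-lookup n i

  *-reciprocal : f * reciprocal ≈ one
  *-reciprocal zero    = trans (ℚ.+-identityʳ _) (ℚ.*-inverseʳ (f 0))
  *-reciprocal (suc n) = begin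
    f 0 ℚ.* ℚ.- (1/ f 0 ℚ.* s) ℚ.+ t    ≡⟨ cong (ℚ._+ t) (ℚ.neg-distribʳ-* (f 0) _) ⟨
    ℚ.- (f 0 ℚ.* (1/ f 0 ℚ.* s)) ℚ.+ t  ≡⟨ cong (λ y → ℚ.- y ℚ.+ t) (ℚ.*-assoc (f 0) (1/ f 0) s) ⟨
    ℚ.- (f 0 ℚ.* 1/ f 0 ℚ.* s) ℚ.+ t    ≡⟨ cong (λ y → ℚ.- (y ℚ.* s) ℚ.+ t) (ℚ.*-inverseʳ (f 0)) ⟩
    ℚ.- (1ℚ ℚ.* s) ℚ.+ t                ≡⟨ cong (λ y → ℚ.- y ℚ.+ t) (ℚ.*-identityˡ s) ⟩
    ℚ.- s ℚ.+ t                         ≡⟨ cong (ℚ.- s ℚ.+_) s≡t ⟨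
    ℚ.- s ℚ.+ s                         ≡⟨ ℚ.+-inverseˡ s ⟩
    0ℚ                                  ∎
    where
    open ≡-Reasoning
    s t : ℚ
    s = sum λ i → f (suc (toℕ i)) ℚ.* reversedPrefix (suc n) i
    t = sum {suc n} λ i → f (suc (toℕ i)) ℚ.* reciprocal (n ∸ toℕ i)
    s≡t : s ≡ t
    s≡t = sum-cong-≗ λ i →
      cong (f (suc (toℕ i)) ℚ.*_) (reversedPrefix-lookup (suc n) i)

egf : (ℕ → ℤ) → Series
egf c n = c n / (n !)
  where instance _ = n ℕ.!≢0

-- n-th derivatives of sin and cos at 0

sin⁽_⁾0 : ℕ → ℤ
sin⁽ 0 ⁾0           = + 0
sin⁽ 1 ⁾0           = + 1
sin⁽ suc (suc n) ⁾0 = ℤ.- sin⁽ n ⁾0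

cos⁽_⁾0 : ℕ → ℤ
cos⁽ 0 ⁾0           = + 1
cos⁽ 1 ⁾0           = + 0
cos⁽ suc (suc n) ⁾0 = ℤ.- cos⁽ n ⁾0

sin cos sec tan : Series
sin = egf sin⁽_⁾0
cos = egf cos⁽_⁾0
sec = reciprocal cos
tan = sin * sec

E : Series
E = egf (λ n → + a n)

{-# OPTIONS --safe #-}
-- Read cyclically, 123, 231 and 312 are the increasing triples, so a permutation
-- avoids all three iff any three consecutive letters turn clockwise (cyclically
-- decrease).  This is invariant under rotating the alphabet, so n + 1 first
-- letters contribute equally to aₙ₊₁.  After …pq, list the unused letters clockwise
-- from q; the next letter r must be among the k of them before p, and choosing the
-- j-th of these leaves m ∸ j allowed letters out of m ∸ 1.  Hence the numbers of
-- completions obey the recurrence E(m, k) = Σ_{1 ≤ j ≤ k} E(m ∸ 1, m ∸ j) of the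
-- Entringer triangle, and aₙ₊₁ = (n + 1) E(n, n).  Iterated differences along a
-- row of the triangle give cos · Σ E(n, n) xⁿ/n! = 1 + sin.

module Submission where

open import Defs

open import Data.Empty using (⊥-elim)
open import Data.Fin.Base as Fin using (Fin; zero; suc; toℕ; opposite)
open import Data.Fin.Patterns using (0F; 1F; 2F)
import Data.Fin.Properties as Fin
open import Data.Integer.Base as ℤ using (ℤ; +_)
import Data.Integer.Properties as ℤ
import Data.Integer.Tactic.RingSolver as ℤ-Solver
open import Data.List.Base using (List; []; _∷_; _++_; map; length; concatMap; allFin; tabulate)
import Data.List.Properties as List
open import Data.List.Membership.Propositional using (_∈_; lose; find)
open import Data.List.Membership.Propositional.Properties
  using (∈-++⁺ˡ; ∈-++⁺ʳ; ∈-++⁻; ∈-∃++; ∈-insert; ∈-map⁺; ∈-map⁻; ∈-concatMap⁺; ∈-concatMap⁻;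
         ∈-allFin; ∈-tabulate⁺; ∈-filter⁺; ∈-filter⁻)
open import Data.List.Membership.Propositional.Properties.WithK using (unique∧set⇒bag)
open import Data.List.Relation.Binary.BagAndSetEquality using (∼bag⇒↭)
open import Data.List.Relation.Binary.Permutation.Propositional.Properties using (↭-length)
open import Data.List.Relation.Unary.All as All using (All; []; _∷_)
import Data.List.Relation.Unary.All.Properties as All
open import Data.List.Relation.Unary.AllPairs as AllPairs using (AllPairs; []; _∷_)
import Data.List.Relation.Unary.AllPairs.Properties as AllPairs
open import Data.List.Relation.Unary.Any using (here; there)
open import Data.List.Relation.Unary.Unique.Propositional using (Unique)
import Data.List.Relation.Unary.Unique.Propositional.Properties as Unique
open import Data.Nat.Base as ℕ using (ℕ; zero; suc; _∸_; _<_; _!; z≤n; s≤s)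
import Data.Nat.Properties as ℕ
open import Data.Product.Base using (∃-syntax; _×_; _,_; proj₁; proj₂)
open import Data.Rational.Base as ℚ using (ℚ; 0ℚ; 1ℚ; _/_)
import Data.Rational.Properties as ℚ
import Data.Rational.Solver as ℚ-Solver
import Data.Rational.Unnormalised.Base as ℚᵘ
import Data.Rational.Unnormalised.Properties as ℚᵘ
open import Data.Sum.Base using (_⊎_; inj₁; inj₂)
open import Data.Unit.Base using (⊤; tt)
open import Data.Vec.Base using (Vec; []; _∷_; lookup)
open import Data.Vec.Properties using (∷-injectiveˡ; ∷-injectiveʳ)
import Data.Vec.Relation.Unary.All as VecAll
import Data.Vec.Relation.Unary.AllPairs as VecAllPairs
import Data.Vec.Relation.Unary.Unique.Propositional as VecUnique
import Data.Vec.Relation.Unary.Unique.Propositional.Properties as VecUnique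
open import Function.Base using (_∘_)
open import Function.Bundles using (mk⇔; Equivalence)
open import Relation.Binary.Definitions using (tri<; tri≈; tri>)
open import Relation.Binary.PropositionalEquality
  using (_≡_; _≢_; refl; sym; trans; cong; cong₂; subst; module ≡-Reasoning)
open import Algebra.Properties.CommutativeMonoid.Sum ℚ.+-0-commutativeMonoid
  using (sum-cong-≗; ∑-distrib-+)
open import Relation.Nullary using (¬_)

open ℚ-Solver.+-*-Solver using (solve; _:=_; _:+_; _:*_; con)

-- Formal power series

*-congˡ : ∀ f {g g′} → g ≈ g′ → f * g ≈ f * g′
*-congˡ f g≈g′ n = sum-cong-≗ {suc n} λ i → cong (f (toℕ i) ℚ.*_) (g≈g′ (n ∸ toℕ i))

*-congʳ : ∀ g {f f′} → f ≈ f′ → f * g ≈ f′ * g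
*-congʳ g f≈f′ n = sum-cong-≗ {suc n} λ i → cong (ℚ._* g (n ∸ toℕ i)) (f≈f′ (toℕ i))

-- By computation a product peels off only its first summand, leaving `f ∘ suc`. This is the mirror
-- recursion, which peels off the last one and leaves `g ∘ suc`.
*-sucʳ : ∀ f g n → (f * g) (suc n) ≡ (f * g ∘ suc) n ℚ.+ f (suc n) ℚ.* g 0
*-sucʳ f g zero    = solve 4 (λ a b c d → a :* b :+ (c :* d :+ con 0ℚ) := a :* b :+ con 0ℚ :+ c :* d)
  refl (f 0) (g 1) (f 1) (g 0)
*-sucʳ f g (suc n) = trans
  (cong (f 0 ℚ.* g (suc (suc n)) ℚ.+_) (*-sucʳ (f ∘ suc) g n))
  (sym (ℚ.+-assoc (f 0 ℚ.* g (suc (suc n))) _ _))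

*-comm : ∀ f g → f * g ≈ g * f
*-comm f g zero    = cong (ℚ._+ 0ℚ) (ℚ.*-comm (f 0) (g 0))
*-comm f g (suc n) = trans
  (cong₂ ℚ._+_ (ℚ.*-comm (f 0) (g (suc n))) (*-comm (f ∘ suc) g n))
  (trans (ℚ.+-comm _ ((g * f ∘ suc) n)) (sym (*-sucʳ g f n)))

*-distribʳ-+ : ∀ f g h → (f + g) * h ≈ f * h + g * h
*-distribʳ-+ f g h n = trans
  (sum-cong-≗ {suc n} λ i → ℚ.*-distribʳ-+ (h (n ∸ toℕ i)) (f (toℕ i)) (g (toℕ i)))
  (∑-distrib-+ {suc n} (λ i → f (toℕ i) ℚ.* h (n ∸ toℕ i)) (λ i → g (toℕ i) ℚ.* h (n ∸ toℕ i)))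

scale : ℚ → Series → Series
scale c f n = c ℚ.* f n

scale-* : ∀ c f g → scale c f * g ≈ scale c (f * g)
scale-* c f g zero    = solve 3 (λ c a b → c :* a :* b :+ con 0ℚ := c :* (a :* b :+ con 0ℚ)) refl c (f 0) (g 0)
scale-* c f g (suc n) = trans
  (cong (c ℚ.* f 0 ℚ.* g (suc n) ℚ.+_) (scale-* c (f ∘ suc) g n))
  (solve 4 (λ c a b s → c :* a :* b :+ c :* s := c :* (a :* b :+ s)) refl c (f 0) (g (suc n)) ((f ∘ suc * g) n))

*-assoc : ∀ f g h → (f * g) * h ≈ f * (g * h)
*-assoc f g h zero    = solve 3 (λ a b c → (a :* b :+ con 0ℚ) :* c :+ con 0ℚ := a :* (b :* c :+ con 0ℚ) :+ con 0ℚ)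
  refl (f 0) (g 0) (h 0)
*-assoc f g h (suc n) = begin
  -- The tail of `f * g` is by computation `scale (f 0) (g ∘ suc) + (f ∘ suc * g)`, so
  -- distributivity and the induction for `f ∘ suc` apply.
  (f 0 ℚ.* g 0 ℚ.+ 0ℚ) ℚ.* h (suc n) ℚ.+ ((scale (f 0) (g ∘ suc) + (f ∘ suc * g)) * h) n
    ≡⟨ cong ((f 0 ℚ.* g 0 ℚ.+ 0ℚ) ℚ.* h (suc n) ℚ.+_)
        (trans (*-distribʳ-+ (scale (f 0) (g ∘ suc)) (f ∘ suc * g) h n)
        (cong₂ ℚ._+_ (scale-* (f 0) (g ∘ suc) h n) (*-assoc (f ∘ suc) g h n))) ⟩
  (f 0 ℚ.* g 0 ℚ.+ 0ℚ) ℚ.* h (suc n) ℚ.+ (f 0 ℚ.* (g ∘ suc * h) n ℚ.+ (f ∘ suc * (g * h)) n)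
    ≡⟨ solve 5 (λ a b c s t → (a :* b :+ con 0ℚ) :* c :+ (a :* s :+ t) := a :* (b :* c :+ s) :+ t) refl
        (f 0) (g 0) (h (suc n)) ((g ∘ suc * h) n) ((f ∘ suc * (g * h)) n) ⟩
  f 0 ℚ.* (g 0 ℚ.* h (suc n) ℚ.+ (g ∘ suc * h) n) ℚ.+ (f ∘ suc * (g * h)) n ∎
  where open ≡-Reasoning

*-zeroˡ : ∀ f → (λ _ → 0ℚ) * f ≈ λ _ → 0ℚ
*-zeroˡ f zero    = trans (ℚ.+-identityʳ _) (ℚ.*-zeroˡ (f 0))
*-zeroˡ f (suc n) = cong₂ ℚ._+_ (ℚ.*-zeroˡ (f (suc n))) (*-zeroˡ f n)

*-identityˡ : ∀ f → one * f ≈ f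
*-identityˡ f zero    = trans (ℚ.+-identityʳ _) (ℚ.*-identityˡ (f 0))
*-identityˡ f (suc n) = trans
  (cong₂ ℚ._+_ (ℚ.*-identityˡ (f (suc n))) (*-zeroˡ f n)) (ℚ.+-identityʳ _)

x*-suc : ∀ f n → (x * f) (suc n) ≡ f n
x*-suc f n = trans
  (cong₂ ℚ._+_ (ℚ.*-zeroˡ (f (suc n))) (trans (*-congʳ f x∘suc n) (*-identityˡ f n)))
  (ℚ.+-identityˡ (f n))
  where
  x∘suc : x ∘ suc ≈ one
  x∘suc zero    = refl
  x∘suc (suc _) = refl

-- Integers as rationals, and clearing factorials

ι : ℤ → ℚ
ι z = z / 1

fromℚᵘ-homo-+ : ∀ p q → ℚ.fromℚᵘ (p ℚᵘ.+ q) ≡ ℚ.fromℚᵘ p ℚ.+ ℚ.fromℚᵘ q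
fromℚᵘ-homo-+ p q = sym (ℚ.toℚᵘ-injective (ℚᵘ.≃-trans (ℚ.toℚᵘ-homo-+ (ℚ.fromℚᵘ p) (ℚ.fromℚᵘ q))
  (ℚᵘ.≃-trans (ℚᵘ.+-cong (ℚ.toℚᵘ-fromℚᵘ p) (ℚ.toℚᵘ-fromℚᵘ q)) (ℚᵘ.≃-sym (ℚ.toℚᵘ-fromℚᵘ (p ℚᵘ.+ q))))))

fromℚᵘ-homo-* : ∀ p q → ℚ.fromℚᵘ (p ℚᵘ.* q) ≡ ℚ.fromℚᵘ p ℚ.* ℚ.fromℚᵘ q
fromℚᵘ-homo-* p q = sym (ℚ.toℚᵘ-injective (ℚᵘ.≃-trans (ℚ.toℚᵘ-homo-* (ℚ.fromℚᵘ p) (ℚ.fromℚᵘ q))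
  (ℚᵘ.≃-trans (ℚᵘ.*-cong (ℚ.toℚᵘ-fromℚᵘ p) (ℚ.toℚᵘ-fromℚᵘ q)) (ℚᵘ.≃-sym (ℚ.toℚᵘ-fromℚᵘ (p ℚᵘ.* q))))))

ι-+ : ∀ y z → ι (y ℤ.+ z) ≡ ι y ℚ.+ ι z
ι-+ y z = trans (cong ι (sym (cong₂ ℤ._+_ (ℤ.*-identityʳ y) (ℤ.*-identityʳ z))))
  (fromℚᵘ-homo-+ (ℚᵘ.mkℚᵘ y 0) (ℚᵘ.mkℚᵘ z 0))

ι-* : ∀ y z → ι (y ℤ.* z) ≡ ι y ℚ.* ι z
ι-* y z = fromℚᵘ-homo-* (ℚᵘ.mkℚᵘ y 0) (ℚᵘ.mkℚᵘ z 0)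

/-*-ι : ∀ z d .{{_ : ℕ.NonZero d}} → z / d ℚ.* ι (+ d) ≡ ι z
/-*-ι z d@(suc k) = trans (sym (fromℚᵘ-homo-* (ℚᵘ.mkℚᵘ z k) (ℚᵘ.mkℚᵘ (+ d) 0)))
  (ℚ.fromℚᵘ-cong {ℚᵘ.mkℚᵘ (z ℤ.* + d) (k ℕ.* 1)} {ℚᵘ.mkℚᵘ z 0}
    (ℚᵘ.*≡* (trans (ℤ.*-identityʳ (z ℤ.* + d)) (cong (λ e → z ℤ.* + e) (sym (ℕ.*-identityʳ d))))))

-- A positive factor cancels from both inequalities, and antisymmetry joins them.
ι-cancel : ∀ d .{{_ : ℕ.NonZero d}} {p q} → p ℚ.* ι (+ d) ≡ q ℚ.* ι (+ d) → p ≡ q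
ι-cancel d@(suc _) eq = ℚ.≤-antisym
  (ℚ.*-cancelʳ-≤-pos (ι (+ d)) (ℚ.≤-reflexive eq))
  (ℚ.*-cancelʳ-≤-pos (ι (+ d)) (ℚ.≤-reflexive (sym eq)))
  where instance _ = ℚ.normalize-pos d 1

ι-! : ∀ n → ι (+ (suc n !)) ≡ ι (+ suc n) ℚ.* ι (+ (n !))
ι-! n = trans (cong ι (ℤ.pos-* (suc n) (n !))) (ι-* (+ suc n) (+ (n !)))

egf-*-! : ∀ c n → egf c n ℚ.* ι (+ (n !)) ≡ ι (c n)
egf-*-! c n = /-*-ι (c n) (n !) {{n ℕ.!≢0}}

-- Identities between exponential coefficients are checked after multiplication by `n !`, where they
-- turn into identities of integers.
!*⇒egf : ∀ {p} c n → p ℚ.* ι (+ (n !)) ≡ ι (c n) → p ≡ egf c n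
!*⇒egf c n eq = ι-cancel (n !) {{n ℕ.!≢0}} (trans eq (sym (egf-*-! c n)))

-- The Euler operator and products of exponential generating functions

θ : Series → Series
θ f n = ι (+ n) ℚ.* f n

-- The Leibniz rule for `θ` = x d/dx, which unlike d/dx keeps the index. In the weight 1 + n, the n
-- goes to the induction for `f ∘ suc`, and the 1 makes up for the weight that shifting `f` takes
-- away.
θ-* : ∀ f g → θ (f * g) ≈ θ f * g + f * θ g
θ-* f g zero = trans (ℚ.*-zeroˡ ((f * g) 0)) (sym (solve 2
  (λ a b → con 0ℚ :* a :* b :+ con 0ℚ :+ (a :* (con 0ℚ :* b) :+ con 0ℚ) := con 0ℚ) refl (f 0) (g 0)))
θ-* f g (suc n) = begin
  ι (+ suc n) ℚ.* (f 0 ℚ.* g (suc n) ℚ.+ (f ∘ suc * g) n)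
    ≡⟨ cong (ℚ._* (f * g) (suc n)) (ι-+ (+ 1) (+ n)) ⟩
  (1ℚ ℚ.+ ι (+ n)) ℚ.* (f 0 ℚ.* g (suc n) ℚ.+ (f ∘ suc * g) n)
    ≡⟨ solve 4 (λ m a b s → (con 1ℚ :+ m) :* (a :* b :+ s) := a :* ((con 1ℚ :+ m) :* b) :+ (s :+ m :* s)) refl
       (ι (+ n)) (f 0) (g (suc n)) ((f ∘ suc * g) n) ⟩
  f 0 ℚ.* ((1ℚ ℚ.+ ι (+ n)) ℚ.* g (suc n)) ℚ.+ ((f ∘ suc * g) n ℚ.+ θ (f ∘ suc * g) n)
    ≡⟨ cong₂ ℚ._+_ (cong (λ m → f 0 ℚ.* (m ℚ.* g (suc n))) (sym (ι-+ (+ 1) (+ n))))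
       (cong ((f ∘ suc * g) n ℚ.+_) (θ-* (f ∘ suc) g n)) ⟩
  f 0 ℚ.* θ g (suc n) ℚ.+ ((f ∘ suc * g) n ℚ.+ ((θ (f ∘ suc) * g) n ℚ.+ (f ∘ suc * θ g) n))
    ≡⟨ solve 4 (λ a p q r → a :+ (p :+ (q :+ r)) := p :+ q :+ (a :+ r)) refl
       (f 0 ℚ.* θ g (suc n)) ((f ∘ suc * g) n) ((θ (f ∘ suc) * g) n) ((f ∘ suc * θ g) n) ⟩
  (f ∘ suc * g) n ℚ.+ (θ (f ∘ suc) * g) n ℚ.+ (f * θ g) (suc n)
    ≡⟨ cong (ℚ._+ (f * θ g) (suc n)) (sym θf*g) ⟩
  (θ f * g) (suc n) ℚ.+ (f * θ g) (suc n) ∎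
  where
  open ≡-Reasoning
  θ-suc : θ f ∘ suc ≈ f ∘ suc + θ (f ∘ suc)
  θ-suc m = trans (cong (ℚ._* f (suc m)) (ι-+ (+ 1) (+ m)))
    (solve 2 (λ m a → (con 1ℚ :+ m) :* a := a :+ m :* a) refl (ι (+ m)) (f (suc m)))
  θf*g : (θ f * g) (suc n) ≡ (f ∘ suc * g) n ℚ.+ (θ (f ∘ suc) * g) n
  θf*g = trans (cong₂ ℚ._+_ (trans (cong (ℚ._* g (suc n)) (ℚ.*-zeroˡ (f 0))) (ℚ.*-zeroˡ (g (suc n))))
     (trans (*-congʳ g θ-suc n) (*-distribʳ-+ (f ∘ suc) (θ (f ∘ suc)) g n))) (ℚ.+-identityˡ _)

-- On exponential generating functions d/dx shifts the sequence; the factor x in `θ` accounts for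
-- the index `suc n`.
θ-egf : ∀ c n → θ (egf c) (suc n) ≡ egf (c ∘ suc) n
θ-egf c n = !*⇒egf (c ∘ suc) n (begin
  ι (+ suc n) ℚ.* egf c (suc n) ℚ.* ι (+ (n !))
    ≡⟨ solve 3 (λ a b c → a :* b :* c := b :* (a :* c)) refl (ι (+ suc n)) (egf c (suc n)) (ι (+ (n !))) ⟩
  egf c (suc n) ℚ.* (ι (+ suc n) ℚ.* ι (+ (n !)))
    ≡⟨ cong (egf c (suc n) ℚ.*_) (sym (ι-! n)) ⟩
  egf c (suc n) ℚ.* ι (+ (suc n !))
    ≡⟨ egf-*-! c (suc n) ⟩
  ι (c (suc n)) ∎)
  where open ≡-Reasoning

infixl 7 _⋆_

-- Binomial convolution, by the Leibniz rule instead of binomial coefficients.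
_⋆_ : (ℕ → ℤ) → (ℕ → ℤ) → ℕ → ℤ
(c ⋆ d) zero    = c 0 ℤ.* d 0
(c ⋆ d) (suc n) = (c ∘ suc ⋆ d) n ℤ.+ (c ⋆ d ∘ suc) n

-- In (n + 1)! the factor n + 1 applies `θ` to the product, the Leibniz rule splits it into the two
-- shifted products that define `_⋆_`, and n! is left for the induction.
egf-⋆ : ∀ c d → egf c * egf d ≈ egf (c ⋆ d)
egf-⋆ c d n = !*⇒egf (c ⋆ d) n (lemma c d n)
  where
  open ≡-Reasoning
  lemma : ∀ c d n → (egf c * egf d) n ℚ.* ι (+ (n !)) ≡ ι ((c ⋆ d) n)
  lemma c d zero    = trans (ℚ.*-identityʳ _) (trans (ℚ.+-identityʳ _) (sym (ι-* (c 0) (d 0))))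
  lemma c d (suc n) = begin
    (egf c * egf d) (suc n) ℚ.* ι (+ (suc n !))
      ≡⟨ cong ((egf c * egf d) (suc n) ℚ.*_) (ι-! n) ⟩
    (egf c * egf d) (suc n) ℚ.* (ι (+ suc n) ℚ.* ι (+ (n !)))
      ≡⟨ solve 3 (λ a b c → a :* (b :* c) := b :* a :* c) refl
         ((egf c * egf d) (suc n)) (ι (+ suc n)) (ι (+ (n !))) ⟩
    θ (egf c * egf d) (suc n) ℚ.* ι (+ (n !))
      ≡⟨ cong (ℚ._* ι (+ (n !))) (θ-* (egf c) (egf d) (suc n)) ⟩
    ((θ (egf c) * egf d) (suc n) ℚ.+ (egf c * θ (egf d)) (suc n)) ℚ.* ι (+ (n !))
      ≡⟨ cong (ℚ._* ι (+ (n !))) (cong₂ ℚ._+_ left right) ⟩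
    ((egf (c ∘ suc) * egf d) n ℚ.+ (egf c * egf (d ∘ suc)) n) ℚ.* ι (+ (n !))
      ≡⟨ ℚ.*-distribʳ-+ (ι (+ (n !))) ((egf (c ∘ suc) * egf d) n) ((egf c * egf (d ∘ suc)) n) ⟩
    (egf (c ∘ suc) * egf d) n ℚ.* ι (+ (n !)) ℚ.+ (egf c * egf (d ∘ suc)) n ℚ.* ι (+ (n !))
      ≡⟨ cong₂ ℚ._+_ (lemma (c ∘ suc) d n) (lemma c (d ∘ suc) n) ⟩
    ι ((c ∘ suc ⋆ d) n) ℚ.+ ι ((c ⋆ d ∘ suc) n)
      ≡⟨ sym (ι-+ ((c ∘ suc ⋆ d) n) _) ⟩
    ι ((c ⋆ d) (suc n)) ∎
    where
    left : (θ (egf c) * egf d) (suc n) ≡ (egf (c ∘ suc) * egf d) n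
    left = trans
      (cong₂ ℚ._+_ (trans (cong (ℚ._* egf d (suc n)) (ℚ.*-zeroˡ (egf c 0))) (ℚ.*-zeroˡ (egf d (suc n))))
                   (*-congʳ (egf d) (θ-egf c) n))
      (ℚ.+-identityˡ _)
    right : (egf c * θ (egf d)) (suc n) ≡ (egf c * egf (d ∘ suc)) n
    right = trans (*-sucʳ (egf c) (θ (egf d)) n) (trans
      (cong₂ ℚ._+_ (*-congˡ (egf c) (θ-egf d) n)
                   (trans (cong (egf c (suc n) ℚ.*_) (ℚ.*-zeroˡ (egf d 0))) (ℚ.*-zeroʳ (egf c (suc n)))))
      (ℚ.+-identityʳ _))

⋆-cong : ∀ {c c′ d d′} → (∀ n → c n ≡ c′ n) → (∀ n → d n ≡ d′ n) → ∀ n → (c ⋆ d) n ≡ (c′ ⋆ d′) n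
⋆-cong c≗c′ d≗d′ zero    = cong₂ ℤ._*_ (c≗c′ 0) (d≗d′ 0)
⋆-cong c≗c′ d≗d′ (suc n) = cong₂ ℤ._+_
  (⋆-cong (c≗c′ ∘ suc) d≗d′ n) (⋆-cong c≗c′ (d≗d′ ∘ suc) n)

⋆-negˡ : ∀ c d n → (ℤ.-_ ∘ c ⋆ d) n ≡ ℤ.- (c ⋆ d) n
⋆-negˡ c d zero    = sym (ℤ.neg-distribˡ-* (c 0) (d 0))
⋆-negˡ c d (suc n) = trans
  (cong₂ ℤ._+_ (⋆-negˡ (c ∘ suc) d n) (⋆-negˡ c (d ∘ suc) n))
  (sym (ℤ.neg-distrib-+ ((c ∘ suc ⋆ d) n) _))

sin⁽suc⁾ : ∀ n → sin⁽ suc n ⁾0 ≡ cos⁽ n ⁾0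
sin⁽suc⁾ 0             = refl
sin⁽suc⁾ 1             = refl
sin⁽suc⁾ (suc (suc n)) = cong ℤ.-_ (sin⁽suc⁾ n)

cos⁽suc⁾ : ∀ n → cos⁽ suc n ⁾0 ≡ ℤ.- sin⁽ n ⁾0
cos⁽suc⁾ 0             = refl
cos⁽suc⁾ 1             = refl
cos⁽suc⁾ (suc (suc n)) = cong ℤ.-_ (cos⁽suc⁾ n)

-- The Entringer triangle

-- The sum in the recurrence is accumulated one term per column. Only columns `k` up to `m` belong
-- to the triangle.
entringer : ℕ → ℕ → ℕ
entringer zero    k       = 1
entringer (suc m) zero    = 0
entringer (suc m) (suc k) = entringer (suc m) k ℕ.+ entringer m (m ∸ k)

euler : ℕ → ℕ
euler n = entringer n n

-- Writing the row as `k + l` removes the truncated subtraction.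
entringer-suc : ∀ k l →
  entringer (suc (k ℕ.+ l)) (suc k) ≡ entringer (suc (k ℕ.+ l)) k ℕ.+ entringer (k ℕ.+ l) l
entringer-suc k l = cong (λ i → entringer (suc (k ℕ.+ l)) k ℕ.+ entringer (k ℕ.+ l) i) (ℕ.m+n∸m≡n k l)

-- The border column 1, 0, 0, ..., which is the unit of `_⋆_`.
entringer₀ : ℕ → ℕ
entringer₀ n = entringer n 0

fromIndex : (ℕ → ℕ) → ℕ → ℕ → ℤ
fromIndex c r i = + c (r ℕ.+ i)

-- Second differences along row m are minus the entries of row m ∸ 2; unrolling
-- them is a discrete rotation, whose binomial weights the Leibniz rule of ⋆ absorbs.
entringer-trig : ∀ j r →
  let e = fromIndex euler r ; δ = fromIndex entringer₀ r in
  + entringer (r ℕ.+ j) r ≡ (cos⁽_⁾0 ⋆ e) j ℤ.- (sin⁽_⁾0 ⋆ δ) j ×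
  + entringer (r ℕ.+ j) j ≡ (sin⁽_⁾0 ⋆ e) j ℤ.+ (cos⁽_⁾0 ⋆ δ) j
entringer-trig zero r rewrite ℕ.+-identityʳ r =
  lemma₁ (+ euler r) (+ entringer₀ r) , lemma₂ (+ euler r) (+ entringer₀ r)
  where
  lemma₁ : ∀ y z → y ≡ + 1 ℤ.* y ℤ.- + 0 ℤ.* z
  lemma₁ = ℤ-Solver.solve-∀
  lemma₂ : ∀ y z → z ≡ + 0 ℤ.* y ℤ.+ + 1 ℤ.* z
  lemma₂ = ℤ-Solver.solve-∀
entringer-trig (suc j) r = cosine , sine
  where
  open ≡-Reasoning
  e δ e′ δ′ : ℕ → ℤ
  e  = fromIndex euler r
  δ  = fromIndex entringer₀ r
  e′ = fromIndex euler (suc r)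
  δ′ = fromIndex entringer₀ (suc r)
  shift : ∀ c n → fromIndex c r (suc n) ≡ fromIndex c (suc r) n
  shift c n = cong (+_ ∘ c) (ℕ.+-suc r n)
  cos⋆ : ∀ c → (cos⁽_⁾0 ⋆ fromIndex c r) (suc j) ≡
         (cos⁽_⁾0 ⋆ fromIndex c (suc r)) j ℤ.- (sin⁽_⁾0 ⋆ fromIndex c r) j
  cos⋆ c = trans (cong₂ ℤ._+_
    (trans (⋆-cong cos⁽suc⁾ (λ _ → refl) j) (⋆-negˡ sin⁽_⁾0 (fromIndex c r) j))
    (⋆-cong (λ _ → refl) (shift c) j)) (ℤ.+-comm (ℤ.- (sin⁽_⁾0 ⋆ fromIndex c r) j) _)
  sin⋆ : ∀ c → (sin⁽_⁾0 ⋆ fromIndex c r) (suc j) ≡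
         (cos⁽_⁾0 ⋆ fromIndex c r) j ℤ.+ (sin⁽_⁾0 ⋆ fromIndex c (suc r)) j
  sin⋆ c = cong₂ ℤ._+_ (⋆-cong sin⁽suc⁾ (λ _ → refl) j) (⋆-cong (λ _ → refl) (shift c) j)
  cosine : + entringer (r ℕ.+ suc j) r ≡ (cos⁽_⁾0 ⋆ e) (suc j) ℤ.- (sin⁽_⁾0 ⋆ δ) (suc j)
  -- The recurrence writes the entry as E(r + 1 + j, r + 1) - E(r + j, j): the cosine claim at
  -- `suc r` minus the sine claim at `r`.
  cosine rewrite ℕ.+-suc r j | cos⋆ euler | sin⋆ entringer₀ = begin
    + entringer (suc (r ℕ.+ j)) r
      ≡⟨ lemma (+ entringer (suc (r ℕ.+ j)) r) (+ entringer (r ℕ.+ j) j) ⟩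
    + entringer (suc (r ℕ.+ j)) r ℤ.+ + entringer (r ℕ.+ j) j ℤ.- + entringer (r ℕ.+ j) j
      ≡⟨ cong₂ ℤ._-_ (trans (cong +_ (sym (entringer-suc r j))) (proj₁ (entringer-trig j (suc r))))
         (proj₂ (entringer-trig j r)) ⟩
    ((cos⁽_⁾0 ⋆ e′) j ℤ.- (sin⁽_⁾0 ⋆ δ′) j) ℤ.- ((sin⁽_⁾0 ⋆ e) j ℤ.+ (cos⁽_⁾0 ⋆ δ) j)
      ≡⟨ rearrange ((cos⁽_⁾0 ⋆ e′) j) ((sin⁽_⁾0 ⋆ δ′) j) ((sin⁽_⁾0 ⋆ e) j) ((cos⁽_⁾0 ⋆ δ) j) ⟩
    ((cos⁽_⁾0 ⋆ e′) j ℤ.- (sin⁽_⁾0 ⋆ e) j) ℤ.- ((cos⁽_⁾0 ⋆ δ) j ℤ.+ (sin⁽_⁾0 ⋆ δ′) j) ∎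
    where
    lemma : ∀ y z → y ≡ y ℤ.+ z ℤ.- z
    lemma = ℤ-Solver.solve-∀
    rearrange : ∀ p q s t → (p ℤ.- q) ℤ.- (s ℤ.+ t) ≡ (p ℤ.- s) ℤ.- (t ℤ.+ q)
    rearrange = ℤ-Solver.solve-∀
  sine : + entringer (r ℕ.+ suc j) (suc j) ≡ (sin⁽_⁾0 ⋆ e) (suc j) ℤ.+ (cos⁽_⁾0 ⋆ δ) (suc j)
  -- Here the recurrence is read with `r` and `j` exchanged, giving the sine claim at `suc r` plus
  -- the cosine claim at `r`.
  sine rewrite ℕ.+-suc r j | cos⋆ entringer₀ | sin⋆ euler = begin
    + entringer (suc (r ℕ.+ j)) (suc j)
      ≡⟨ cong (λ m → + entringer (suc m) (suc j)) (ℕ.+-comm r j) ⟩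
    + entringer (suc (j ℕ.+ r)) (suc j)
      ≡⟨ cong +_ (entringer-suc j r) ⟩
    + entringer (suc (j ℕ.+ r)) j ℤ.+ + entringer (j ℕ.+ r) r
      ≡⟨ cong (λ m → + entringer (suc m) j ℤ.+ + entringer m r) (ℕ.+-comm j r) ⟩
    + entringer (suc (r ℕ.+ j)) j ℤ.+ + entringer (r ℕ.+ j) r
      ≡⟨ cong₂ ℤ._+_ (proj₂ (entringer-trig j (suc r))) (proj₁ (entringer-trig j r)) ⟩
    ((sin⁽_⁾0 ⋆ e′) j ℤ.+ (cos⁽_⁾0 ⋆ δ′) j) ℤ.+ ((cos⁽_⁾0 ⋆ e) j ℤ.- (sin⁽_⁾0 ⋆ δ) j)
      ≡⟨ rearrange ((sin⁽_⁾0 ⋆ e′) j) ((cos⁽_⁾0 ⋆ δ′) j) ((cos⁽_⁾0 ⋆ e) j) ((sin⁽_⁾0 ⋆ δ) j) ⟩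
    ((cos⁽_⁾0 ⋆ e) j ℤ.+ (sin⁽_⁾0 ⋆ e′) j) ℤ.+ ((cos⁽_⁾0 ⋆ δ′) j ℤ.- (sin⁽_⁾0 ⋆ δ) j) ∎
    where
    rearrange : ∀ p q s t → (p ℤ.+ q) ℤ.+ (s ℤ.- t) ≡ (s ℤ.+ p) ℤ.+ (q ℤ.- t)
    rearrange = ℤ-Solver.solve-∀

-- The generating function of the Euler numbers

⋆-zeroʳ : ∀ c n → (c ⋆ λ _ → + 0) n ≡ + 0
⋆-zeroʳ c zero    = ℤ.*-zeroʳ (c 0)
⋆-zeroʳ c (suc n) = cong₂ ℤ._+_ (⋆-zeroʳ (c ∘ suc) n) (⋆-zeroʳ c n)

⋆-identityʳ : ∀ c n → (c ⋆ (+_ ∘ entringer₀)) n ≡ c n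
⋆-identityʳ c zero    = ℤ.*-identityʳ (c 0)
⋆-identityʳ c (suc n) = trans
  (cong₂ ℤ._+_ (⋆-identityʳ (c ∘ suc) n) (⋆-zeroʳ c n)) (ℤ.+-identityʳ (c (suc n)))

-- The cosine half of `entringer-trig` at `r` = 0, where the left side is the border column and the
-- sine derivatives are convolved with the unit.
cos⋆euler : ∀ n → (cos⁽_⁾0 ⋆ (+_ ∘ euler)) n ≡ + entringer₀ n ℤ.+ sin⁽ n ⁾0
cos⋆euler n = begin
  c                                                 ≡⟨ lemma c s ⟩
  c ℤ.- s ℤ.+ s                                     ≡⟨ cong (ℤ._+ s) (sym (proj₁ (entringer-trig n 0))) ⟩
  + entringer₀ n ℤ.+ s                              ≡⟨ cong (λ z → + entringer₀ n ℤ.+ z) (⋆-identityʳ sin⁽_⁾0 n) ⟩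
  + entringer₀ n ℤ.+ sin⁽ n ⁾0                      ∎
  where
  open ≡-Reasoning
  c s : ℤ
  c = (cos⁽_⁾0 ⋆ (+_ ∘ euler)) n
  s = (sin⁽_⁾0 ⋆ (+_ ∘ entringer₀)) n
  lemma : ∀ y z → y ≡ y ℤ.- z ℤ.+ z
  lemma = ℤ-Solver.solve-∀

egf-+ : ∀ c d → egf (λ n → c n ℤ.+ d n) ≈ egf c + egf d
egf-+ c d n = sym (!*⇒egf (λ m → c m ℤ.+ d m) n (trans
  (ℚ.*-distribʳ-+ (ι (+ (n !))) (egf c n) (egf d n))
  (trans (cong₂ ℚ._+_ (egf-*-! c n) (egf-*-! d n)) (sym (ι-+ (c n) (d n))))))

egf-entringer₀ : egf (+_ ∘ entringer₀) ≈ one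
egf-entringer₀ zero    = refl
egf-entringer₀ (suc n) = sym (!*⇒egf (+_ ∘ entringer₀) (suc n) (ℚ.*-zeroˡ (ι (+ (suc n !)))))

cos*egf-euler : cos * egf (+_ ∘ euler) ≈ one + sin
cos*egf-euler n = begin
  (cos * egf (+_ ∘ euler)) n                           ≡⟨ egf-⋆ cos⁽_⁾0 (+_ ∘ euler) n ⟩
  egf (cos⁽_⁾0 ⋆ (+_ ∘ euler)) n                       ≡⟨ cong (λ z → _/_ z (n !) {{n ℕ.!≢0}}) (cos⋆euler n) ⟩
  egf (λ m → + entringer₀ m ℤ.+ sin⁽ m ⁾0) n           ≡⟨ egf-+ (+_ ∘ entringer₀) sin⁽_⁾0 n ⟩
  egf (+_ ∘ entringer₀) n ℚ.+ sin n                    ≡⟨ cong (ℚ._+ sin n) (egf-entringer₀ n) ⟩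
  one n ℚ.+ sin n                                      ∎
  where open ≡-Reasoning

-- Multiplying cos · S = 1 + sin by `sec` divides it by cos, and `sin * sec` is `tan` by definition.
egf-euler : egf (+_ ∘ euler) ≈ sec + tan
egf-euler n = begin
  S n                        ≡⟨ *-identityˡ S n ⟨
  (one * S) n                ≡⟨ *-congʳ S (*-reciprocal cos) n ⟨
  (cos * sec * S) n          ≡⟨ *-congʳ S (*-comm cos sec) n ⟩
  (sec * cos * S) n          ≡⟨ *-assoc sec cos S n ⟩
  (sec * (cos * S)) n        ≡⟨ *-congˡ sec cos*egf-euler n ⟩
  (sec * (one + sin)) n      ≡⟨ *-comm sec (one + sin) n ⟩
  ((one + sin) * sec) n      ≡⟨ *-distribʳ-+ one sin sec n ⟩
  (one * sec) n ℚ.+ tan n    ≡⟨ cong (ℚ._+ tan n) (*-identityˡ sec n) ⟩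
  sec n ℚ.+ tan n            ∎
  where
  open ≡-Reasoning
  S : Series
  S = egf (+_ ∘ euler)

-- Clockwise words

private
  variable
    m n N : ℕ

-- Each constructor's name lists the letters in increasing order. The three cases are the patterns
-- 321, 132 and 213, the complement of the forbidden ones.
data Clockwise {N} (a b c : Fin N) : Set where
  cba : c Fin.< b → b Fin.< a → Clockwise a b c
  acb : a Fin.< c → c Fin.< b → Clockwise a b c
  bac : b Fin.< a → a Fin.< c → Clockwise a b c

module _ {a b c : Fin N} where

  rotate : Clockwise a b c → Clockwise b c a
  rotate (cba c<b b<a) = bac c<b b<a
  rotate (acb a<c c<b) = cba a<c c<b
  rotate (bac b<a a<c) = acb b<a a<c

  clockwise-asym : Clockwise a b c → ¬ Clockwise a c b
  clockwise-asym (cba c<b b<a) (cba b<c c<a) = ℕ.<-asym b<c c<b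
  clockwise-asym (cba c<b b<a) (acb a<b b<c) = ℕ.<-asym b<c c<b
  clockwise-asym (cba c<b b<a) (bac c<a a<b) = ℕ.<-asym a<b b<a
  clockwise-asym (acb a<c c<b) (cba b<c c<a) = ℕ.<-asym b<c c<b
  clockwise-asym (acb a<c c<b) (acb a<b b<c) = ℕ.<-asym b<c c<b
  clockwise-asym (acb a<c c<b) (bac c<a a<b) = ℕ.<-asym c<a a<c
  clockwise-asym (bac b<a a<c) (cba b<c c<a) = ℕ.<-asym c<a a<c
  clockwise-asym (bac b<a a<c) (acb a<b b<c) = ℕ.<-asym a<b b<a
  clockwise-asym (bac b<a a<c) (bac c<a a<b) = ℕ.<-asym a<b b<a

  clockwise⇒≢ : Clockwise a b c → b ≢ c
  clockwise⇒≢ (cba c<b _)   b≡c = Fin.<⇒≢ c<b (sym b≡c)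
  clockwise⇒≢ (acb _ c<b)   b≡c = Fin.<⇒≢ c<b (sym b≡c)
  clockwise⇒≢ (bac b<a a<c) b≡c = Fin.<⇒≢ (ℕ.<-trans b<a a<c) b≡c

  -- Cutting the circle at a makes it a line along which b, c, d follow one another. The conclusion
  -- leaves out a because it serves to move the base point.
  clockwise-trans : ∀ {d} → Clockwise a b c → Clockwise a c d → Clockwise b c d
  clockwise-trans (cba c<b b<a) (cba d<c c<a) = cba d<c c<b
  clockwise-trans (cba c<b b<a) (acb a<d d<c) = ⊥-elim (ℕ.<-asym a<d (ℕ.<-trans d<c (ℕ.<-trans c<b b<a)))
  clockwise-trans (cba c<b b<a) (bac c<a a<d) = bac c<b (ℕ.<-trans b<a a<d)
  clockwise-trans (acb a<c c<b) (cba d<c c<a) = ⊥-elim (ℕ.<-asym a<c c<a)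
  clockwise-trans (acb a<c c<b) (acb a<d d<c) = cba d<c c<b
  clockwise-trans (acb a<c c<b) (bac c<a a<d) = ⊥-elim (ℕ.<-asym a<c c<a)
  clockwise-trans (bac b<a a<c) (cba d<c c<a) = ⊥-elim (ℕ.<-asym a<c c<a)
  clockwise-trans (bac b<a a<c) (acb a<d d<c) = acb (ℕ.<-trans b<a a<d) d<c
  clockwise-trans (bac b<a a<c) (bac c<a a<d) = ⊥-elim (ℕ.<-asym a<c c<a)

-- Lists in clockwise order

AllPairs-insert⁻ : ∀ {A : Set} {R : A → A → Set} xs {y zs} → AllPairs R (xs ++ y ∷ zs) →
                   All (λ x → R x y) xs × All (R y) zs × AllPairs R (xs ++ zs)
AllPairs-insert⁻ []       (Ry ∷ ps) = [] , Ry , ps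
AllPairs-insert⁻ (x ∷ xs) (Rx ∷ ps)
  with AllPairs-insert⁻ xs ps | All.++⁻ xs Rx
... | Ry , Rz , qs | Rxs , Rxy ∷ Rxzs = Rxy ∷ Ry , Rz , All.++⁺ Rxs Rxzs ∷ qs

-- The circle cut open at `q` is linearly ordered, so being sorted clockwise is a condition on
-- pairs.
ClockwiseFrom : Fin N → List (Fin N) → Set
ClockwiseFrom q = AllPairs (Clockwise q)

-- When the first letter becomes the base point, the old one moves to the end: pairs inside `L`
-- follow from `clockwise-trans`, pairs with `q` from `rotate`.
clockwiseFrom-rotate₁ : ∀ {q s : Fin N} {L} →
                        ClockwiseFrom q (s ∷ L) → ClockwiseFrom s (L ++ q ∷ [])
clockwiseFrom-rotate₁ {q = q} {s} (qs ∷ ps) =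
  AllPairs.++⁺ (shift qs ps) ([] ∷ []) (All.map (λ c → rotate c ∷ []) qs)
  where
  shift : ∀ {L} → All (Clockwise q s) L → ClockwiseFrom q L → ClockwiseFrom s L
  shift []       []       = []
  shift (c ∷ cs) (d ∷ ds) = All.map (clockwise-trans c) d ∷ shift cs ds

clockwiseFrom-rotate : ∀ {q r : Fin N} xs {ys} →
                       ClockwiseFrom q (xs ++ r ∷ ys) → ClockwiseFrom r (ys ++ q ∷ xs)
clockwiseFrom-rotate []       ps = clockwiseFrom-rotate₁ ps
clockwiseFrom-rotate {q = q} {r} (x ∷ xs) {ys} ps =
  subst (ClockwiseFrom r) (List.++-assoc ys (q ∷ []) (x ∷ xs))
    (clockwiseFrom-rotate xs
      (subst (ClockwiseFrom x) (List.++-assoc xs (r ∷ ys) (q ∷ [])) (clockwiseFrom-rotate₁ ps)))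

-- The effect of choosing `r` after `q`: the letters passed over must not follow `r`, the later ones
-- may, and the new list is the rotated one with the used letter `q` deleted.
clockwiseFrom-step : ∀ {q r : Fin N} xs {ys} B → ClockwiseFrom q ((xs ++ r ∷ ys) ++ B) →
  All (λ s → Clockwise q s r) xs × All (Clockwise q r) (ys ++ B) × ClockwiseFrom r ((ys ++ B) ++ xs)
clockwiseFrom-step {q = q} {r} xs {ys} B ps =
  let ps′ = subst (ClockwiseFrom q) (List.++-assoc xs (r ∷ ys) B) ps
      before , after , _ = AllPairs-insert⁻ xs ps′
      _ , _ , rest = AllPairs-insert⁻ (ys ++ B) (clockwiseFrom-rotate xs ps′)
  in before , after , rest

-- A word is grown from its last letter q, whose unused letters are listed
-- clockwise from q as A ++ B, with A the letters allowed next.  After r ∈ A the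
-- letters passed over on the way to r become the forbidden ones.
extensions : ∀ m → List (Fin N) → List (Fin N) → List (Vec (Fin N) m)
branches   : ∀ m → List (Fin N) → List (Fin N) → List (Fin N) → List (Vec (Fin N) (suc m))

extensions zero    A B = [] ∷ []
extensions (suc m) A B = branches m [] A B

branches m xs []       B = []
branches m xs (r ∷ ys) B = map (r ∷_) (extensions m (ys ++ B) xs) ++ branches m (xs ++ r ∷ []) ys B

∈-branches⁺ : ∀ ws xs {r : Fin N} {ys B} {w : Vec (Fin N) m} → w ∈ extensions m (ys ++ B) (ws ++ xs) →
              (r ∷ w) ∈ branches m ws (xs ++ r ∷ ys) B
∈-branches⁺ {m = m} ws [] {r} {ys} {B} {w} w∈ = ∈-++⁺ˡ (∈-map⁺ (r ∷_)
  (subst (λ zs → w ∈ extensions m (ys ++ B) zs) (List.++-identityʳ ws) w∈))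
∈-branches⁺ {m = m} ws (x ∷ xs) {r} {ys} {B} {w} w∈ = ∈-++⁺ʳ _ (∈-branches⁺ (ws ++ x ∷ []) xs
  (subst (λ zs → w ∈ extensions m (ys ++ B) zs) (sym (List.++-assoc ws (x ∷ []) xs)) w∈))

∈-branches⁻ : ∀ ws (A B : List (Fin N)) {w : Vec (Fin N) (suc m)} → w ∈ branches m ws A B →
              ∃[ xs ] ∃[ r ] ∃[ ys ] ∃[ w′ ]
              A ≡ xs ++ r ∷ ys × w ≡ r ∷ w′ × w′ ∈ extensions m (ys ++ B) (ws ++ xs)
∈-branches⁻ {m = m} ws (r ∷ ys) B w∈ with ∈-++⁻ (map (r ∷_) (extensions m (ys ++ B) ws)) w∈
... | inj₁ w∈map with w′ , w′∈ , refl ← ∈-map⁻ (r ∷_) w∈map =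
  [] , r , ys , w′ , refl , refl , subst (λ zs → w′ ∈ extensions m (ys ++ B) zs) (sym (List.++-identityʳ ws)) w′∈
... | inj₂ w∈rest with xs , r′ , ys′ , w′ , refl , refl , w′∈ ← ∈-branches⁻ (ws ++ r ∷ []) ys B w∈rest =
  r ∷ xs , r′ , ys′ , w′ , refl , refl , subst (λ zs → w′ ∈ extensions m (ys′ ++ B) zs) (List.++-assoc ws (r ∷ []) xs) w′∈

-- Counting the extensions

length-extensions : ∀ m (A B : List (Fin N)) → length A ℕ.+ length B ≡ m →
                    length (extensions m A B) ≡ entringer m (length A)
-- A telescoping sum along row `suc m`: the branch that passes over k letters leaves m - k allowed
-- ones, so it contributes exactly the step from column k to column k + 1.
length-branches   : ∀ m (xs A B : List (Fin N)) → length xs ℕ.+ (length A ℕ.+ length B) ≡ suc m →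
                    length (branches m xs A B) ℕ.+ entringer (suc m) (length xs) ≡
                    entringer (suc m) (length xs ℕ.+ length A)

length-extensions zero    A B eq = refl
-- With no letter passed over yet, the extra term is `entringer (suc m) 0`, that is 0.
length-extensions (suc m) A B eq = trans (sym (ℕ.+-identityʳ _)) (length-branches m [] A B eq)

length-branches m xs []       B eq = cong (entringer (suc m)) (sym (ℕ.+-identityʳ (length xs)))
length-branches m xs (r ∷ ys) B eq = begin
  length (map (r ∷_) (extensions m (ys ++ B) xs) ++ rest) ℕ.+ e
    ≡⟨ cong (ℕ._+ e) (trans (List.length-++ (map (r ∷_) (extensions m (ys ++ B) xs)))
         (cong (ℕ._+ length rest) (trans (List.length-map (r ∷_) (extensions m (ys ++ B) xs))
            (length-extensions m (ys ++ B) xs (trans (ℕ.+-comm (length (ys ++ B)) k) k+l≡m))))) ⟩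
  entringer m l ℕ.+ length rest ℕ.+ e
    ≡⟨ cong (ℕ._+ e) (ℕ.+-comm (entringer m l) (length rest)) ⟩
  length rest ℕ.+ entringer m l ℕ.+ e
    ≡⟨ ℕ.+-assoc (length rest) (entringer m l) e ⟩
  length rest ℕ.+ (entringer m l ℕ.+ e)
    ≡⟨ cong (length rest ℕ.+_) (ℕ.+-comm (entringer m l) e) ⟩
  length rest ℕ.+ (e ℕ.+ entringer m l)
    ≡⟨ cong (λ i → length rest ℕ.+ (e ℕ.+ entringer m i)) (trans (sym (ℕ.m+n∸m≡n k l)) (cong (_∸ k) k+l≡m)) ⟩
  length rest ℕ.+ entringer (suc m) (suc k)
    ≡⟨ cong (λ i → length rest ℕ.+ entringer (suc m) i) (sym length-snoc) ⟩
  length rest ℕ.+ entringer (suc m) (length (xs ++ r ∷ []))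
    ≡⟨ length-branches m (xs ++ r ∷ []) ys B (trans (cong (ℕ._+ (length ys ℕ.+ length B)) length-snoc)
         (trans (sym (ℕ.+-suc k (length ys ℕ.+ length B))) eq)) ⟩
  entringer (suc m) (length (xs ++ r ∷ []) ℕ.+ length ys)
    ≡⟨ cong (entringer (suc m)) (trans (cong (ℕ._+ length ys) length-snoc) (sym (ℕ.+-suc k (length ys)))) ⟩
  entringer (suc m) (k ℕ.+ length (r ∷ ys)) ∎
  where
  open ≡-Reasoning
  k = length xs
  l = length (ys ++ B)
  e = entringer (suc m) k
  rest = branches m (xs ++ r ∷ []) ys B
  k+l≡m : k ℕ.+ l ≡ m
  k+l≡m = ℕ.suc-injective (trans (sym (ℕ.+-suc k l))
    (trans (cong (λ i → k ℕ.+ suc i) (List.length-++ ys)) eq))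
  length-snoc : length (xs ++ r ∷ []) ≡ suc k
  length-snoc = trans (List.length-++ xs) (ℕ.+-comm k 1)

-- Extensions are distinct, sound and complete

extensions-unique : ∀ m {q : Fin N} A B → ClockwiseFrom q (A ++ B) → Unique (extensions m A B)
branches-unique   : ∀ m {q : Fin N} xs A B → ClockwiseFrom q ((xs ++ A) ++ B) → Unique (branches m xs A B)

extensions-unique zero    A B ps = [] ∷ []
extensions-unique (suc m) A B ps = branches-unique m [] A B ps

branches-unique m     xs []       B ps = []
branches-unique m {q} xs (r ∷ ys) B ps with clockwiseFrom-step xs B ps
... | _ , after , rest = Unique.++⁺
  (Unique.map⁺ ∷-injectiveʳ (extensions-unique m (ys ++ B) xs rest))
  (branches-unique m (xs ++ r ∷ []) ys B
    (subst (λ zs → ClockwiseFrom q (zs ++ B)) (sym (List.++-assoc xs (r ∷ []) ys)) ps))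
  λ (w∈map , w∈rest) → disjoint w∈map w∈rest
  where
  -- A common word would force `r` to occur in `ys` as well, yet every letter of `ys` follows `r`
  -- clockwise from `q` and so differs from it.
  disjoint : ∀ {w} → w ∈ map (r ∷_) (extensions m (ys ++ B) xs) → ¬ w ∈ branches m (xs ++ r ∷ []) ys B
  disjoint w∈map w∈rest
    with _ , _ , refl ← ∈-map⁻ (r ∷_) w∈map
    with us , _ , _ , _ , refl , refl , _ ← ∈-branches⁻ (xs ++ r ∷ []) ys B w∈rest
    = clockwise⇒≢ (All.lookup after (∈-++⁺ˡ (∈-insert us))) refl

-- `P` is the condition that the letters up to `q` impose on the next one; after a step to `r` it
-- becomes `Clockwise q r`.
Path : (Fin N → Set) → Fin N → Vec (Fin N) m → Set
Path P q []      = ⊤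
Path P q (r ∷ w) = P r × Path (Clockwise q r) r w

Injective : Vec (Fin N) m → Set
Injective = VecUnique.Unique

module _ (xs : List (Fin N)) {r : Fin N} (ys B : List (Fin N)) where

  ∈-step⁻ : ∀ {s} → s ∈ (ys ++ B) ++ xs → s ∈ (xs ++ r ∷ ys) ++ B
  ∈-step⁻ {s} s∈ = subst (s ∈_) (sym (List.++-assoc xs (r ∷ ys) B)) go
    where
    go : s ∈ xs ++ r ∷ (ys ++ B)
    go with ∈-++⁻ (ys ++ B) s∈
    ... | inj₁ s∈ys = ∈-++⁺ʳ xs (there s∈ys)
    ... | inj₂ s∈xs = ∈-++⁺ˡ s∈xs

  ∈-step⁺ : ∀ {s} → r ≢ s → s ∈ (xs ++ r ∷ ys) ++ B → s ∈ (ys ++ B) ++ xs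
  ∈-step⁺ {s} r≢s s∈ with ∈-++⁻ xs (subst (s ∈_) (List.++-assoc xs (r ∷ ys) B) s∈)
  ... | inj₁ s∈xs         = ∈-++⁺ʳ (ys ++ B) s∈xs
  ... | inj₂ (here s≡r)   = ⊥-elim (r≢s (sym s≡r))
  ... | inj₂ (there s∈ys) = ∈-++⁺ˡ s∈ys

-- The invariant is that all allowed letters satisfy `P`; `clockwiseFrom-step` renews it for
-- `Clockwise q r`.
extensions-sound : ∀ m {P} {q : Fin N} A B {w} → ClockwiseFrom q (A ++ B) → All P A → w ∈ extensions m A B →
                   Injective w × VecAll.All (_∈ A ++ B) w × Path P q w
extensions-sound zero    A B {[]} ps PA w∈ = VecAllPairs.[] , VecAll.[] , tt
extensions-sound (suc m) A B ps PA w∈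
  with xs , r , ys , w , refl , refl , w∈′ ← ∈-branches⁻ [] A B w∈
  with before , after , rest ← clockwiseFrom-step xs B ps
  with w! , w⊆ , path ← extensions-sound m (ys ++ B) xs rest after w∈′
  = VecAll.map r≢ w⊆ VecAllPairs.∷ w!
  , ∈-++⁺ˡ (∈-insert xs) VecAll.∷ VecAll.map (∈-step⁻ xs ys B) w⊆
  , All.lookup PA (∈-insert xs)
  , path
  where
  r≢ : ∀ {s} → s ∈ (ys ++ B) ++ xs → r ≢ s
  r≢ s∈ with ∈-++⁻ (ys ++ B) s∈
  ... | inj₁ s∈ys = clockwise⇒≢ (All.lookup after s∈ys)
  ... | inj₂ s∈xs = clockwise⇒≢ (All.lookup before s∈xs) ∘ sym

-- The dual invariant, that forbidden letters violate `P`, puts the next letter into `A`. For the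
-- letters newly passed over it holds by `clockwise-asym`.
extensions-complete : ∀ m {P} {q : Fin N} A B {w} → ClockwiseFrom q (A ++ B) → All (λ s → ¬ P s) B →
                      Injective w → VecAll.All (_∈ A ++ B) w → Path P q w → w ∈ extensions m A B
extensions-complete zero    A B {[]} ps ¬PB w! w⊆ path = here refl
extensions-complete (suc m) A B {r ∷ w} ps ¬PB (r∉w VecAllPairs.∷ w!) (r∈ VecAll.∷ w⊆) (Pr , path)
  with ∈-++⁻ A r∈
... | inj₂ r∈B = ⊥-elim (All.lookup ¬PB r∈B Pr)
... | inj₁ r∈A
  with xs , ys , refl ← ∈-∃++ r∈A
  with before , after , rest ← clockwiseFrom-step xs B ps
  = ∈-branches⁺ [] xs (extensions-complete m (ys ++ B) xs rest (All.map clockwise-asym before) w!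
      (VecAll.map (λ (r≢s , s∈) → ∈-step⁺ xs ys B r≢s s∈) (VecAll.zip (r∉w , w⊆))) path)

-- Words grown from a given first letter

descending⇒clockwiseFrom : ∀ {q : Fin N} {L} → All (q Fin.>_) L → AllPairs Fin._>_ L → ClockwiseFrom q L
descending⇒clockwiseFrom []          []         = []
descending⇒clockwiseFrom (q>s ∷ q>L) (s>L ∷ L↓) =
  All.map (λ t<s → cba t<s q>s) s>L ∷ descending⇒clockwiseFrom q>L L↓

record Others (q : Fin (suc n)) : Set where
  field
    letters   : List (Fin (suc n))
    clockwise : ClockwiseFrom q letters
    -- `clockwise` does not give this: it says nothing about a list of one letter.
    distinct  : All (q ≢_) letters
    complete  : ∀ {s} → q ≢ s → s ∈ letters
    length≡   : length letters ≡ n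

∈-tabulate-opposite : (q : Fin n) → q ∈ tabulate opposite
∈-tabulate-opposite q =
  subst (_∈ tabulate opposite) (Fin.opposite-involutive q) (∈-tabulate⁺ (opposite q))

tabulate-opposite-descending : ∀ n → AllPairs Fin._>_ (tabulate {n = n} opposite)
tabulate-opposite-descending n = AllPairs.tabulate⁺-< anti
  where
  anti : ∀ {i j : Fin n} → i Fin.< j → opposite j Fin.< opposite i
  anti {i} {j} i<j rewrite Fin.opposite-prop i | Fin.opposite-prop j =
    ℕ.∸-monoʳ-< (s≤s i<j) (Fin.toℕ<n j)

-- The descending list of all letters runs clockwise from its first entry, so splitting it at `q`
-- and exchanging the two parts makes it run clockwise from `q`.
others : (q : Fin (suc n)) → Others q
others {n} q with xs , ys , eq ← ∈-∃++ (∈-tabulate-opposite q) = record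
  { letters   = ys ++ xs
  ; clockwise = from-split xs descending
  ; distinct  = let xs>q , q>ys , _ = AllPairs-insert⁻ xs descending in
      All.++⁺ (All.map (λ s<q → Fin.<⇒≢ s<q ∘ sym) q>ys) (All.map Fin.<⇒≢ xs>q)
  ; complete  = complete
  ; length≡   = ℕ.suc-injective (begin
      suc (length (ys ++ xs))          ≡⟨ cong suc (List.length-++ ys) ⟩
      length (q ∷ ys) ℕ.+ length xs    ≡⟨ ℕ.+-comm (length (q ∷ ys)) (length xs) ⟩
      length xs ℕ.+ length (q ∷ ys)    ≡⟨ List.length-++ xs ⟨
      length (xs ++ q ∷ ys)            ≡⟨ cong length eq ⟨
      length (tabulate {n = suc n} opposite) ≡⟨ List.length-tabulate {n = suc n} opposite ⟩
      suc n                            ∎)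
  }
  where
  open ≡-Reasoning
  descending : AllPairs Fin._>_ (xs ++ q ∷ ys)
  descending = subst (AllPairs Fin._>_) eq (tabulate-opposite-descending (suc n))
  from-split : ∀ xs {ys} → AllPairs Fin._>_ (xs ++ q ∷ ys) → ClockwiseFrom q (ys ++ xs)
  from-split []       {ys} (q>ys ∷ ys↓) =
    subst (ClockwiseFrom q) (sym (List.++-identityʳ ys)) (descending⇒clockwiseFrom q>ys ys↓)
  from-split (x ∷ xs) {ys} (x>L ∷ L↓) =
    clockwiseFrom-rotate xs (descending⇒clockwiseFrom x>L L↓)
  complete : ∀ {s} → q ≢ s → s ∈ ys ++ xs
  complete {s} q≢s with ∈-++⁻ xs (subst (s ∈_) eq (∈-tabulate-opposite s))
  ... | inj₁ s∈xs         = ∈-++⁺ʳ ys s∈xs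
  ... | inj₂ (here s≡q)   = ⊥-elim (q≢s (sym s≡q))
  ... | inj₂ (there s∈ys) = ∈-++⁺ˡ s∈ys

-- No factor of three letters ends at the second letter, so every letter but `q` is allowed there
-- and the forbidden list is empty.
startingWith : Fin (suc n) → List (Vec (Fin (suc n)) (suc n))
startingWith {n} q = map (q ∷_) (extensions n (Others.letters (others q)) [])

listing : ∀ n → List (Vec (Fin (suc n)) (suc n))
listing n = concatMap startingWith (allFin (suc n))

length-concatMap : ∀ {A B : Set} (f : A → List B) k → (∀ y → length (f y) ≡ k) →
                   ∀ ys → length (concatMap f ys) ≡ length ys ℕ.* k
length-concatMap f k eq []       = refl
length-concatMap f k eq (y ∷ ys) =
  trans (List.length-++ (f y)) (cong₂ ℕ._+_ (eq y) (length-concatMap f k eq ys))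

length-listing : ∀ n → length (listing n) ≡ suc n ℕ.* euler n
length-listing n = trans
  (length-concatMap startingWith (euler n) length-startingWith (allFin (suc n)))
  (cong (ℕ._* euler n) (List.length-tabulate {n = suc n} (λ i → i)))
  where
  length-startingWith : ∀ q → length (startingWith q) ≡ euler n
  length-startingWith q = trans
    (List.length-map (q ∷_) (extensions n letters []))
    (trans (length-extensions n letters [] (trans (ℕ.+-identityʳ (length letters)) length≡))
           (cong (entringer n) length≡))
    where open Others (others q)

others-clockwise : (q : Fin (suc n)) → ClockwiseFrom q (Others.letters (others q) ++ [])
others-clockwise q = subst (ClockwiseFrom q) (sym (List.++-identityʳ _)) (Others.clockwise (others q))

listing-unique : ∀ n → Unique (listing n)
listing-unique n = Unique.concat⁺
  (All.map⁺ (All.universal (λ q → Unique.map⁺ ∷-injectiveʳ (extensions-unique n _ [] (others-clockwise q))) _))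
  (AllPairs.map⁺ (AllPairs.map disjoint (Unique.allFin⁺ (suc n))))
  where
  disjoint : ∀ {p q} → p ≢ q → ∀ {w} → ¬ (w ∈ startingWith p × w ∈ startingWith q)
  disjoint {p} {q} p≢q (w∈p , w∈q)
    with _ , _ , refl ← ∈-map⁻ (p ∷_) w∈p
    with _ , _ , eq ← ∈-map⁻ (q ∷_) w∈q
    = p≢q (∷-injectiveˡ eq)

-- Paths and consecutive factors

ClockwiseFactors : Vec (Fin N) m → Set
ClockwiseFactors v = ∀ i j k → toℕ j ≡ suc (toℕ i) → toℕ k ≡ suc (toℕ j) →
  Clockwise (lookup v i) (lookup v j) (lookup v k)

path⇒factors : ∀ {P} (q : Fin N) (w : Vec (Fin N) m) → Path P q w → ClockwiseFactors (q ∷ w)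
path⇒factors q (r ∷ s ∷ w) (_ , c , _) zero (suc zero) (suc (suc zero)) refl refl = c
path⇒factors q (r ∷ w) (_ , path) (suc i) (suc j) (suc k) j≡1+i k≡1+j =
  path⇒factors r w path i j k (ℕ.suc-injective j≡1+i) (ℕ.suc-injective k≡1+j)

-- The factors of `q ∷ w` cannot yield the condition `P` on the letter after `q`, so it is assumed
-- of all letters.
factors⇒path : ∀ {P} (q : Fin N) (w : Vec (Fin N) m) → (∀ s → P s) → ClockwiseFactors (q ∷ w) → Path P q w
factors⇒path q []      all cf = tt
factors⇒path q (r ∷ w) all cf = all r , go q r w cf
  where
  go : ∀ q r (w : Vec (Fin _) m) → ClockwiseFactors (q ∷ r ∷ w) → Path (Clockwise q r) r w
  go q r []      cf = tt
  go q r (s ∷ w) cf = cf zero (suc zero) (suc (suc zero)) refl refl ,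
    go r s w λ i j k j≡1+i k≡1+j → cf (suc i) (suc j) (suc k) (cong suc j≡1+i) (cong suc k≡1+j)

∈-listing⁻ : ∀ {π} → π ∈ listing n → Injective π × ClockwiseFactors π
∈-listing⁻ {n} π∈
  with q , _ , π∈q ← find (∈-concatMap⁻ startingWith {xs = allFin (suc n)} π∈)
  with w , w∈ , refl ← ∈-map⁻ (q ∷_) π∈q
  with w! , w⊆ , path ← extensions-sound n {λ _ → ⊤} _ [] (others-clockwise q) (All.universal (λ _ → tt) _) w∈
  = VecAll.map (λ s∈ → All.lookup (All.++⁺ (Others.distinct (others q)) []) s∈) w⊆ VecAllPairs.∷ w!
  , path⇒factors q w path

∈-listing⁺ : ∀ {q} {w : Vec (Fin (suc n)) n} → Injective (q ∷ w) → ClockwiseFactors (q ∷ w) → (q ∷ w) ∈ listing n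
∈-listing⁺ {n} {q} {w} (q∉w VecAllPairs.∷ w!) cf =
  ∈-concatMap⁺ startingWith (lose (∈-allFin q) (∈-map⁺ (q ∷_)
    (extensions-complete n (Others.letters (others q)) [] (others-clockwise q) [] w!
      (VecAll.map (λ q≢s → ∈-++⁺ˡ (Others.complete (others q) q≢s)) q∉w) (factors⇒path q w (λ _ → tt) cf))))

-- Forbidden patterns and clockwise triples

SameOrder : ℕ → ℕ → ℕ → ℕ → Set
SameOrder a b y z = (a < b × y < z) ⊎ (b < a × z < y)

-- `SameOrder` is strict, so three comparisons settle all nine: asymmetry decides the reversed pairs
-- and irreflexivity the diagonal.
orderIsomorphic₃ : ∀ {a b c y z t} → SameOrder a b y z → SameOrder b c z t → SameOrder a c y t →
                   OrderIsomorphic (a ∷ b ∷ c ∷ []) (y ∷ z ∷ t ∷ [])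
orderIsomorphic₃ {a} {b} {c} {y} {z} {t} ab bc ac = λ
  { zero             zero             → irreflexive {a} {y}
  ; zero             (suc zero)       → forwards ab
  ; zero             (suc (suc zero)) → forwards ac
  ; (suc zero)       zero             → backwards ab
  ; (suc zero)       (suc zero)       → irreflexive {b} {z}
  ; (suc zero)       (suc (suc zero)) → forwards bc
  ; (suc (suc zero)) zero             → backwards ac
  ; (suc (suc zero)) (suc zero)       → backwards bc
  ; (suc (suc zero)) (suc (suc zero)) → irreflexive {c} {t}
  }
  where
  irreflexive : ∀ {a y} → _
  irreflexive {a} {y} = mk⇔ (λ a<a → ⊥-elim (ℕ.<-irrefl {a} refl a<a)) (λ y<y → ⊥-elim (ℕ.<-irrefl {y} refl y<y))
  forwards : ∀ {a b y z} → SameOrder a b y z → _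
  forwards (inj₁ (a<b , y<z)) = mk⇔ (λ _ → y<z) (λ _ → a<b)
  forwards (inj₂ (b<a , z<y)) = mk⇔ (λ a<b → ⊥-elim (ℕ.<-asym a<b b<a)) (λ y<z → ⊥-elim (ℕ.<-asym y<z z<y))
  backwards : ∀ {a b y z} → SameOrder a b y z → _
  backwards (inj₁ (a<b , y<z)) = mk⇔ (λ b<a → ⊥-elim (ℕ.<-asym a<b b<a)) (λ z<y → ⊥-elim (ℕ.<-asym y<z z<y))
  backwards (inj₂ (b<a , z<y)) = mk⇔ (λ _ → z<y) (λ _ → b<a)

triple : Fin N → Fin N → Fin N → Vec ℕ 3
triple a b c = toℕ a ∷ toℕ b ∷ toℕ c ∷ []

1<2 : 1 < 2
1<2 = s≤s (s≤s z≤n)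

2<3 : 2 < 3
2<3 = s≤s 1<2

1<3 : 1 < 3
1<3 = s≤s (s≤s z≤n)

≢⇒<⊎> : {a b : Fin N} → a ≢ b → a Fin.< b ⊎ b Fin.< a
≢⇒<⊎> {a = a} {b} a≢b with Fin.<-cmp a b
... | tri< a<b _   _   = inj₁ a<b
... | tri≈ _   a≡b _   = ⊥-elim (a≢b a≡b)
... | tri> _   _   b<a = inj₂ b<a

module _ {a b c : Fin N} where

  -- With `b` and `c` exchanged, each forbidden pattern is one of the constructors of `Clockwise`,
  -- which `clockwise-asym` excludes.
  clockwise⇒avoids : Clockwise a b c →
    ¬ OrderIsomorphic (triple a b c) p123 ×
    ¬ OrderIsomorphic (triple a b c) p231 ×
    ¬ OrderIsomorphic (triple a b c) p312
  clockwise⇒avoids cw =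
      (λ oi → clockwise-asym cw (acb (pull p123 oi 0F 1F 1<2) (pull p123 oi 1F 2F 2<3)))
    , (λ oi → clockwise-asym cw (bac (pull p231 oi 2F 0F 1<2) (pull p231 oi 0F 1F 2<3)))
    , (λ oi → clockwise-asym cw (cba (pull p312 oi 1F 2F 1<2) (pull p312 oi 2F 0F 2<3)))
    where
    pull : ∀ τ → OrderIsomorphic (triple a b c) τ → ∀ i j → lookup τ i < lookup τ j →
           lookup (triple a b c) i < lookup (triple a b c) j
    pull τ oi i j = Equivalence.from (oi i j)

  avoids⇒clockwise : a ≢ b → b ≢ c → a ≢ c →
    ¬ OrderIsomorphic (triple a b c) p123 →
    ¬ OrderIsomorphic (triple a b c) p231 →
    ¬ OrderIsomorphic (triple a b c) p312 → Clockwise a b c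
  avoids⇒clockwise a≢b b≢c a≢c ¬123 ¬231 ¬312 with ≢⇒<⊎> a≢b | ≢⇒<⊎> b≢c | ≢⇒<⊎> a≢c
  ... | inj₁ a<b | inj₁ b<c | _        = ⊥-elim (¬123 (orderIsomorphic₃
          (inj₁ (a<b , 1<2)) (inj₁ (b<c , 2<3)) (inj₁ (ℕ.<-trans a<b b<c , 1<3))))
  ... | inj₁ a<b | inj₂ c<b | inj₁ a<c = acb a<c c<b
  ... | inj₁ a<b | inj₂ c<b | inj₂ c<a = ⊥-elim (¬231 (orderIsomorphic₃
          (inj₁ (a<b , 2<3)) (inj₂ (c<b , 1<3)) (inj₂ (c<a , 1<2))))
  ... | inj₂ b<a | inj₁ b<c | inj₁ a<c = bac b<a a<c
  ... | inj₂ b<a | inj₁ b<c | inj₂ c<a = ⊥-elim (¬312 (orderIsomorphic₃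
          (inj₂ (b<a , 1<3)) (inj₁ (b<c , 1<2)) (inj₂ (c<a , 2<3))))
  ... | inj₂ b<a | inj₂ c<b | _        = cba c<b b<a

avoidsAll⇒clockwise : {π : Vec (Fin n) n} → Injective π → AvoidsAll π → ClockwiseFactors π
avoidsAll⇒clockwise {π = π} π! (¬123 , ¬231 , ¬312) i j k j≡1+i k≡1+j = avoids⇒clockwise
  (distinct i<j) (distinct j<k) (distinct (ℕ.<-trans i<j j<k))
  (λ oi → ¬123 (i , j , k , j≡1+i , k≡1+j , oi))
  (λ oi → ¬231 (i , j , k , j≡1+i , k≡1+j , oi))
  (λ oi → ¬312 (i , j , k , j≡1+i , k≡1+j , oi))
  where
  i<j : i Fin.< j
  i<j = ℕ.≤-reflexive (sym j≡1+i)
  j<k : j Fin.< k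
  j<k = ℕ.≤-reflexive (sym k≡1+j)
  distinct : ∀ {s t} → s Fin.< t → lookup π s ≢ lookup π t
  distinct {s} {t} s<t eq = Fin.<⇒≢ s<t (VecUnique.lookup-injective π! s t eq)

clockwise⇒avoidsAll : {π : Vec (Fin n) n} → ClockwiseFactors π → AvoidsAll π
clockwise⇒avoidsAll {π = π} cf =
    (λ (i , j , k , j≡1+i , k≡1+j , oi) → proj₁ (clockwise⇒avoids (cf i j k j≡1+i k≡1+j)) oi)
  , (λ (i , j , k , j≡1+i , k≡1+j , oi) → proj₁ (proj₂ (clockwise⇒avoids (cf i j k j≡1+i k≡1+j))) oi)
  , (λ (i , j , k , j≡1+i , k≡1+j , oi) → proj₂ (proj₂ (clockwise⇒avoids (cf i j k j≡1+i k≡1+j))) oi)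

-- Counting the avoiders

∈-avoiders⁺ : {π : Vec (Fin n) n} → Injective π → ClockwiseFactors π → π ∈ avoiders n
∈-avoiders⁺ {π = π} π! cf =
  ∈-filter⁺ avoidsAll? (∈-filter⁺ isPermutation? (∈-words π) π!) (clockwise⇒avoidsAll {π = π} cf)

∈-avoiders⁻ : {π : Vec (Fin n) n} → π ∈ avoiders n → Injective π × ClockwiseFactors π
∈-avoiders⁻ {n} {π} π∈ =
  let π∈perms , avoids = ∈-filter⁻ avoidsAll? {xs = permutations n} π∈
      _ , π! = ∈-filter⁻ isPermutation? {xs = words n n} π∈perms
  in π! , avoidsAll⇒clockwise π! avoids

avoiders-unique : ∀ n → Unique (avoiders n)
avoiders-unique n = Unique.filter⁺ avoidsAll? (Unique.filter⁺ isPermutation? (words-unique n n))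

-- Two lists without repetitions that have the same members are rearrangements of each other, hence
-- equally long.
a-suc : ∀ n → a (suc n) ≡ suc n ℕ.* euler n
a-suc n = trans
  (↭-length (∼bag⇒↭ (unique∧set⇒bag (avoiders-unique (suc n)) (listing-unique n) (mk⇔ to from))))
  (length-listing n)
  where
  to : ∀ {π} → π ∈ avoiders (suc n) → π ∈ listing n
  to {_ ∷ _} π∈ = let π! , cf = ∈-avoiders⁻ π∈ in ∈-listing⁺ π! cf
  from : ∀ {π} → π ∈ listing n → π ∈ avoiders (suc n)
  from π∈ = let π! , cf = ∈-listing⁻ π∈ in ∈-avoiders⁺ π! cf

-- The n + 1 choices of the first letter cancel the factor n + 1 of (n + 1)!. This produces the
-- factor x of the final formula.
egf-euler-a : ∀ n → egf (+_ ∘ euler) n ≡ E (suc n)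
egf-euler-a n = !*⇒egf (+_ ∘ a) (suc n) (begin
  e ℚ.* ι (+ (suc n !))                ≡⟨ cong (e ℚ.*_) (ι-! n) ⟩
  e ℚ.* (ι (+ suc n) ℚ.* ι (+ (n !)))  ≡⟨ solve 3 (λ e k m → e :* (k :* m) := k :* (e :* m)) refl
                                            e (ι (+ suc n)) (ι (+ (n !))) ⟩
  ι (+ suc n) ℚ.* (e ℚ.* ι (+ (n !)))  ≡⟨ cong (ι (+ suc n) ℚ.*_) (egf-*-! (+_ ∘ euler) n) ⟩
  ι (+ suc n) ℚ.* ι (+ euler n)        ≡⟨ ι-* (+ suc n) (+ euler n) ⟨
  ι (+ suc n ℤ.* + euler n)            ≡⟨ cong ι (ℤ.pos-* (suc n) (euler n)) ⟨
  ι (+ (suc n ℕ.* euler n))            ≡⟨ cong (ι ∘ +_) (a-suc n) ⟨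
  ι (+ a (suc n))                      ∎)
  where
  open ≡-Reasoning
  e : ℚ
  e = egf (+_ ∘ euler) n

theorem1 : E ≈ one + x * (sec + tan)
theorem1 zero    = sym (cong (1ℚ ℚ.+_) (trans (ℚ.+-identityʳ _) (ℚ.*-zeroˡ ((sec + tan) 0))))
theorem1 (suc n) = sym (begin
  0ℚ ℚ.+ (x * (sec + tan)) (suc n)  ≡⟨ ℚ.+-identityˡ _ ⟩
  (x * (sec + tan)) (suc n)         ≡⟨ x*-suc (sec + tan) n ⟩
  (sec + tan) n                     ≡⟨ egf-euler n ⟨
  egf (+_ ∘ euler) n                ≡⟨ egf-euler-a n ⟩
  E (suc n)                         ∎)
  where open ≡-Reasoning
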